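{- Let $$\kappa(x,y) := (x^{*} \lor y^{**})^{**} \land [(x \lor x^{*})^{+} \lor x^{*} \lor y \lor y^{*}],\qquad \kappa^d(x,y) := (x^{+} \land y^{++})^{++} \lor [(x \land x^{+})^{*} \land x^{+} \land y \land y^{+}].$$ (a) If $\mathbf A = \langle A, \vee, \wedge, \to, {}^+, 0, 1 \rangle \in \mathbb{RDPCH}$ is a regular dually pseudocomplemented Heyting algebra (with $x^* := x\to 0$), then $\mathbf A \models x \to y \approx \kappa(x,y)$. (b) If $\mathbf A = \langle A, \vee, \wedge, {}^*, \leftarrow, 0, 1 \rangle \in \mathbb{RPCH}^d$ is a regular pseudocomplemented dual Heyting algebra (with $x^+ := x\leftarrow 1$), then $\mathbf A \models x \leftarrow y \approx \kappa^d(x,y)$. (c) If $\mathbf A = \langle A, \vee, \wedge, \to, \leftarrow, 0, 1 \rangle \in \mathbb{RDBLH}$ is a regular double Heyting algebra (with $x^* := x\to 0$ and $x^+ := x\leftarrow 1$), then (i) $\mathbf A \models x \to y \approx \kappa(x,y)$ and (ii) $\mathbf A \models x \leftarrow y \approx \kappa^d(x,y)$.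
   Context: A (distributive) p-algebra is a bounded distributive lattice with a unary operation ${}^*$ such that $x^*$ is the largest $z$ with $x\wedge z=0$. A dual p-algebra is a bounded distributive lattice with a unary operation ${}^+$ such that $x^+$ is the least $z$ with $x\vee z=1$. In a Heyting algebra $x\to y$ is the largest $z$ with $x\wedge z\le y$; in a dual Heyting algebra $x\leftarrow y$ is the least $z$ with $y\le x\vee z$. $\mathbb{RDPCH}$ (regular dually pseudocomplemented Heyting algebras): algebras $\langle A,\vee,\wedge,\to,{}^+,0,1\rangle$ such that $\langle A,\vee,\wedge,\to,0,1\rangle$ is a Heyting algebra, $\langle A,\vee,\wedge,{}^+,0,1\rangle$ is a dual p-algebra, and, with $x^*:=x\to 0$, the regularity identity $(x\wedge x^+)\vee(y\vee y^*)\approx y\vee y^*$ (i.e. $x\wedge x^+\le y\vee y^*$) holds. $\mathbb{RPCH}^d$ (regular pseudocomplemented dual Heyting algebras): algebras $\langle A,\vee,\wedge,{}^*,\leftarrow,0,1\rangle$ that are order-duals of members of $\mathbb{RDPCH}$, i.e. the $\vee,\wedge,{}^*,0,1$-reduct is a p-algebra, the $\vee,\wedge,\leftarrow,0,1$-reduct is a dual Heyting algebra, and, with $x^+:=x\leftarrow 1$, the same regularity identity holds. $\mathbb{RDBLH}$ (regular double Heyting algebras): algebras $\langle A,\vee,\wedge,\to,\leftarrow,0,1\rangle$ that are both Heyting algebras (via $\to$) and dual Heyting algebras (via $\leftarrow$) and satisfy the regularity identity with $x^*:=x\to0$, $x^+:=x\leftarrow1$. -}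

module Defs where

open import Algebra.Core using (Op₁; Op₂)
open import Algebra.Definitions using (_DistributesOverˡ_)
open import Data.Product.Base using (_×_)
open import Level using (Level; suc; _⊔_)
open import Relation.Binary.Core using (Rel)
open import Relation.Binary.Lattice.Structures using (IsBoundedLattice; IsHeytingAlgebra)

module _ {a ℓ₁ ℓ₂ : Level} {A : Set a} (_≈_ : Rel A ℓ₁) (_≤_ : Rel A ℓ₂) where

  record IsPAlgebra (_∨_ _∧_ : Op₂ A) (_* : Op₁ A) (⊤ ⊥ : A) : Set (a ⊔ ℓ₁ ⊔ ℓ₂) where
    field
      isBoundedLattice : IsBoundedLattice _≈_ _≤_ _∨_ _∧_ ⊤ ⊥
      ∧-distribˡ-∨     : _DistributesOverˡ_ _≈_ _∧_ _∨_
      pseudocomplement : ∀ x → ((x ∧ (x *)) ≈ ⊥) × (∀ z → (x ∧ z) ≈ ⊥ → z ≤ (x *))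

    open IsBoundedLattice isBoundedLattice public

  record IsDualPAlgebra (_∨_ _∧_ : Op₂ A) (_⁺ : Op₁ A) (⊤ ⊥ : A) : Set (a ⊔ ℓ₁ ⊔ ℓ₂) where
    field
      isBoundedLattice     : IsBoundedLattice _≈_ _≤_ _∨_ _∧_ ⊤ ⊥
      ∧-distribˡ-∨         : _DistributesOverˡ_ _≈_ _∧_ _∨_
      dualPseudocomplement : ∀ x → ((x ∨ (x ⁺)) ≈ ⊤) × (∀ z → (x ∨ z) ≈ ⊤ → (x ⁺) ≤ z)

    open IsBoundedLattice isBoundedLattice public

  -- x ⇦ y is the least z with y ≤ x ∨ z; note that x is the subtracted argument.
  record IsDualHeytingAlgebra (_∨_ _∧_ _⇦_ : Op₂ A) (⊤ ⊥ : A) : Set (a ⊔ ℓ₁ ⊔ ℓ₂) where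
    field
      isBoundedLattice : IsBoundedLattice _≈_ _≤_ _∨_ _∧_ ⊤ ⊥
      dualExponential  : ∀ x y → (y ≤ (x ∨ (x ⇦ y))) × (∀ z → y ≤ (x ∨ z) → (x ⇦ y) ≤ z)

    open IsBoundedLattice isBoundedLattice public

module Terms {a : Level} {A : Set a} (join meet : Op₂ A) (pc dpc : Op₁ A) where

  private
    infixr 6 _∨_
    infixr 7 _∧_
    infixl 8 _* _⁺

    _∨_ _∧_ : Op₂ A
    _∨_ = join
    _∧_ = meet

    _* _⁺ : Op₁ A
    _* = pc
    _⁺ = dpc

  Regular : ∀ {ℓ} → Rel A ℓ → Set (a ⊔ ℓ)
  Regular _≈_ = ∀ x y → ((x ∧ x ⁺) ∨ (y ∨ y *)) ≈ (y ∨ y *)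

  κ : Op₂ A
  κ x y = (x * ∨ y * *) * * ∧ ((x ∨ x *) ⁺ ∨ x * ∨ y ∨ y *)

  κᵈ : Op₂ A
  κᵈ x y = (x ⁺ ∧ y ⁺ ⁺) ⁺ ⁺ ∨ ((x ∧ x ⁺) * ∧ x ⁺ ∧ y ∧ y ⁺)

-- Regular dually pseudocomplemented Heyting algebras.
record RDPCH (c ℓ₁ ℓ₂ : Level) : Set (suc (c ⊔ ℓ₁ ⊔ ℓ₂)) where
  infix  4 _≈_ _≤_
  infixr 5 _⇨_
  infixr 6 _∨_
  infixr 7 _∧_
  infixl 8 _* _⁺
  field
    Carrier          : Set c
    _≈_              : Rel Carrier ℓ₁
    _≤_              : Rel Carrier ℓ₂
    _∨_ _∧_ _⇨_      : Op₂ Carrier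
    _⁺               : Op₁ Carrier
    ⊤ ⊥              : Carrier
    isHeytingAlgebra : IsHeytingAlgebra _≈_ _≤_ _∨_ _∧_ _⇨_ ⊤ ⊥
    isDualPAlgebra   : IsDualPAlgebra _≈_ _≤_ _∨_ _∧_ _⁺ ⊤ ⊥

  _* : Op₁ Carrier
  x * = x ⇨ ⊥

  open Terms _∨_ _∧_ _* _⁺ public

  field
    regular : Regular _≈_

-- Regular pseudocomplemented dual Heyting algebras: the order-duals of RDPCH.
-- The regularity identity is self-dual, so it is imposed unchanged.
record RPCHᵈ (c ℓ₁ ℓ₂ : Level) : Set (suc (c ⊔ ℓ₁ ⊔ ℓ₂)) where
  infix  4 _≈_ _≤_
  infixr 5 _⇦_
  infixr 6 _∨_
  infixr 7 _∧_
  infixl 8 _* _⁺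
  field
    Carrier              : Set c
    _≈_                  : Rel Carrier ℓ₁
    _≤_                  : Rel Carrier ℓ₂
    _∨_ _∧_              : Op₂ Carrier
    _*                   : Op₁ Carrier
    _⇦_                  : Op₂ Carrier
    ⊤ ⊥                  : Carrier
    isPAlgebra           : IsPAlgebra _≈_ _≤_ _∨_ _∧_ _* ⊤ ⊥
    isDualHeytingAlgebra : IsDualHeytingAlgebra _≈_ _≤_ _∨_ _∧_ _⇦_ ⊤ ⊥

  _⁺ : Op₁ Carrier
  x ⁺ = x ⇦ ⊤

  open Terms _∨_ _∧_ _* _⁺ public

  field
    regular : Regular _≈_

-- Regular double Heyting algebras.
record RDBLH (c ℓ₁ ℓ₂ : Level) : Set (suc (c ⊔ ℓ₁ ⊔ ℓ₂)) where
  infix  4 _≈_ _≤_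
  infixr 5 _⇨_ _⇦_
  infixr 6 _∨_
  infixr 7 _∧_
  infixl 8 _* _⁺
  field
    Carrier              : Set c
    _≈_                  : Rel Carrier ℓ₁
    _≤_                  : Rel Carrier ℓ₂
    _∨_ _∧_ _⇨_ _⇦_      : Op₂ Carrier
    ⊤ ⊥                  : Carrier
    isHeytingAlgebra     : IsHeytingAlgebra _≈_ _≤_ _∨_ _∧_ _⇨_ ⊤ ⊥
    isDualHeytingAlgebra : IsDualHeytingAlgebra _≈_ _≤_ _∨_ _∧_ _⇦_ ⊤ ⊥

  _* : Op₁ Carrier
  x * = x ⇨ ⊥

  _⁺ : Op₁ Carrier
  x ⁺ = x ⇦ ⊤

  open Terms _∨_ _∧_ _* _⁺ public

  field
    regular : Regular _≈_

{-# OPTIONS --safe #-}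

-- Both implications are recovered from the double p-algebra reduct alone: in a
-- regular double p-algebra κ x y is already the largest z with x ∧ z ≤ y.
--
-- x ∧ κ x y ≤ y: the factor (x* ∨ y**)** makes x ∧ κ x y disjoint from y*, and the
-- part of it below (x ∨ x*)⁺ lies below x ∧ x⁺, which regularity bounds by y ∨ y*.
-- If x ∧ z ≤ y, then z meets (x* ∨ y**)* in ⊥, and splitting z along
-- ⊤ = (x ∨ x*) ∨ (x ∨ x*)⁺ puts it below the second factor of κ.
--
-- Regular double p-algebras are closed under order-duality, which exchanges κ and κᵈ.
module Submission where

open import Defs
open import Algebra.Core using (Op₁; Op₂)
open import Algebra.Definitions using (_DistributesOverˡ_)
open import Data.Product.Base using (_×_; _,_; proj₁; proj₂)
open import Function.Base using (flip)
open import Level using (Level)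
open import Relation.Binary.Core using (Rel)
open import Relation.Binary.Lattice.Bundles using (DistributiveLattice; HeytingAlgebra)
open import Relation.Binary.Lattice.Structures using (IsHeytingAlgebra)
import Relation.Binary.Lattice.Properties.DistributiveLattice as Distributive
import Relation.Binary.Lattice.Properties.HeytingAlgebra as Heyting
import Relation.Binary.Lattice.Properties.JoinSemilattice as Join
import Relation.Binary.Lattice.Properties.Lattice as Lat
import Relation.Binary.Lattice.Properties.MeetSemilattice as Meet

private
  variable
    a ℓ₁ ℓ₂ : Level

module RegularDoublePAlgebra
  {A : Set a} {_≈_ : Rel A ℓ₁} {_≤_ : Rel A ℓ₂}
  {_∨_ _∧_ : Op₂ A} {_* _⁺ : Op₁ A} {⊤ ⊥ : A}
  (isPAlgebra     : IsPAlgebra _≈_ _≤_ _∨_ _∧_ _* ⊤ ⊥)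
  (isDualPAlgebra : IsDualPAlgebra _≈_ _≤_ _∨_ _∧_ _⁺ ⊤ ⊥)
  (regular        : Terms.Regular _∨_ _∧_ _* _⁺ _≈_)
  where

  open Terms _∨_ _∧_ _* _⁺
  open IsPAlgebra isPAlgebra
  open IsDualPAlgebra isDualPAlgebra using (dualPseudocomplement)

  distributiveLattice : DistributiveLattice _ _ _
  distributiveLattice = record
    { isDistributiveLattice = record
      { isLattice    = isLattice
      ; ∧-distribˡ-∨ = ∧-distribˡ-∨
      }
    }

  open DistributiveLattice distributiveLattice using (lattice; joinSemilattice; meetSemilattice)
  open Distributive distributiveLattice using (∨-distribˡ-∧)
  open Join joinSemilattice using (∨-monotonic)
  open Meet meetSemilattice using (∧-monotonic; y≤x⇒x∧y≈y)

  -- Proof by cases from distributivity: `z` is the join of `z ∧ u` and `z ∧ v`. Keeping `z` in each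
  -- case preserves every bound already known for it.
  ∨-elim : ∀ {u v w z} → z ≤ (u ∨ v) → (z ∧ u) ≤ w → (z ∧ v) ≤ w → z ≤ w
  ∨-elim z≤u∨v z∧u≤w z∧v≤w =
    trans (∧-greatest refl z≤u∨v)
      (trans (reflexive (∧-distribˡ-∨ _ _ _)) (∨-least z∧u≤w z∧v≤w))

  *-intro : ∀ {x z} → (x ∧ z) ≤ ⊥ → z ≤ (x *)
  *-intro x∧z≤⊥ = proj₂ (pseudocomplement _) _ (antisym x∧z≤⊥ (minimum _))

  -- Ex falso: such a `z` lies below `x ∧ (x *)`, which is `⊥`, so the target `w` is arbitrary.
  *-elim : ∀ {x z w} → z ≤ x → z ≤ (x *) → z ≤ w
  *-elim z≤x z≤x* =
    trans (∧-greatest z≤x z≤x*) (trans (reflexive (proj₁ (pseudocomplement _))) (minimum _))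

  *-antitone : ∀ {x y} → x ≤ y → (y *) ≤ (x *)
  *-antitone x≤y = *-intro (*-elim (trans (x∧y≤x _ _) x≤y) (x∧y≤y _ _))

  ≤x∨x⁺ : ∀ {z} x → z ≤ (x ∨ (x ⁺))
  ≤x∨x⁺ x = trans (maximum _) (reflexive (Eq.sym (proj₁ (dualPseudocomplement x))))

  ⁺-antitone : ∀ {x y} → x ≤ y → (y ⁺) ≤ (x ⁺)
  ⁺-antitone x≤y = proj₂ (dualPseudocomplement _) _
    (antisym (maximum _) (trans (≤x∨x⁺ _) (∨-monotonic x≤y refl)))

  x∧x⁺≤y∨y* : ∀ x y → (x ∧ (x ⁺)) ≤ (y ∨ (y *))
  x∧x⁺≤y∨y* x y = trans (x≤x∨y _ _) (reflexive (regular x y))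

  x∧κ≤y : ∀ x y → (x ∧ κ x y) ≤ y
  x∧κ≤y x y =
    ∨-elim (trans p≤κ (x∧y≤y _ _))
      -- The case `(x ∨ x *) ⁺`: it lies below `x ⁺` by antitonicity, so regularity applies, and the
      -- new split is on `y` against `y *`.
      (∨-elim
        (trans
          (∧-greatest (trans (x∧y≤x _ _) p≤x) (trans (x∧y≤y _ _) (⁺-antitone (x≤x∨y _ _))))
          (x∧x⁺≤y∨y* x y))
        (x∧y≤y _ _)
        (disjoint (trans (x∧y≤x _ _) (x∧y≤x _ _)) (x∧y≤y _ _)))
      (∨-elim (x∧y≤y _ _)
        (*-elim (trans (x∧y≤x _ _) (trans (x∧y≤x _ _) p≤x)) (x∧y≤y _ _))
        (∨-elim (x∧y≤y _ _)
          (x∧y≤y _ _)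
          (disjoint (trans (x∧y≤x _ _) (trans (x∧y≤x _ _) (x∧y≤x _ _))) (x∧y≤y _ _))))
    where
    p≤x : (x ∧ κ x y) ≤ x
    p≤x = x∧y≤x _ _

    p≤κ : (x ∧ κ x y) ≤ κ x y
    p≤κ = x∧y≤y _ _

    x∧y*≤[x*∨y**]* : (x ∧ (y *)) ≤ (((x *) ∨ ((y *) *)) *)
    x∧y*≤[x*∨y**]* = *-intro
      (∨-elim (x∧y≤x _ _)
        (*-elim (trans (x∧y≤x _ _) (trans (x∧y≤y _ _) (x∧y≤x _ _))) (x∧y≤y _ _))
        (*-elim (trans (x∧y≤x _ _) (trans (x∧y≤y _ _) (x∧y≤y _ _))) (x∧y≤y _ _)))

    -- With `m` for `(x *) ∨ ((y *) *)`, such a `z` lies below `x ∧ (y *)`, hence below `m *`, while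
    -- the first factor of `κ x y` is `(m *) *`.
    disjoint : ∀ {z w} → z ≤ (x ∧ κ x y) → z ≤ (y *) → z ≤ w
    disjoint z≤p z≤y* =
      *-elim (trans (∧-greatest (trans z≤p p≤x) z≤y*) x∧y*≤[x*∨y**]*)
        (trans z≤p (trans p≤κ (x∧y≤x _ _)))

  κ-greatest : ∀ {x y z} → (x ∧ z) ≤ y → z ≤ κ x y
  κ-greatest {x} {y} {z} x∧z≤y = ∧-greatest (*-intro n∧z≤⊥)
    (∨-elim (≤x∨x⁺ (x ∨ (x *)))
      (∨-elim (x∧y≤y _ _)
        -- On the part below `x` the hypothesis gives `y`; the parts below `x *` and `(x ∨ x *) ⁺`
        -- are already joinands of the second factor.
        (trans (∧-greatest (x∧y≤y _ _) (trans (x∧y≤x _ _) (x∧y≤x _ _)))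
          (trans x∧z≤y (trans (x≤x∨y _ _) (trans (y≤x∨y _ _) (y≤x∨y _ _)))))
        (trans (x∧y≤y _ _) (trans (x≤x∨y _ _) (y≤x∨y _ _))))
      (trans (x∧y≤y _ _) (x≤x∨y _ _)))
    where
    n : A
    n = ((x *) ∨ ((y *) *)) *

    -- Meeting with `x` lands below both `y` and `y *`. Since `n` is below `(x *) *` and
    -- `((y *) *) *`, this bound forces first `n ∧ z ≤ ((y *) *)` and then `n ∧ z ≤ ⊥`.
    y*∧[n∧z]≤x* : ((y *) ∧ (n ∧ z)) ≤ (x *)
    y*∧[n∧z]≤x* = *-intro
      (*-elim
        (trans (∧-monotonic refl (trans (x∧y≤y _ _) (x∧y≤y _ _))) x∧z≤y)
        (trans (x∧y≤y _ _) (x∧y≤x _ _)))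

    n∧z≤y** : (n ∧ z) ≤ ((y *) *)
    n∧z≤y** = *-intro
      (*-elim y*∧[n∧z]≤x*
        (trans (x∧y≤y _ _) (trans (x∧y≤x _ _) (*-antitone (x≤x∨y _ _)))))

    n∧z≤⊥ : (n ∧ z) ≤ ⊥
    n∧z≤⊥ = *-elim n∧z≤y** (trans (x∧y≤x _ _) (*-antitone (y≤x∨y _ _)))

  -- Stated for any `e` with the universal property of `x → y`, so that in the opposite order it
  -- also covers `⇦`.
  κ-unique : ∀ {x y e} → (x ∧ e) ≤ y → (∀ z → (x ∧ z) ≤ y → z ≤ e) → e ≈ κ x y
  κ-unique x∧e≤y greatest = antisym (κ-greatest x∧e≤y) (greatest _ (x∧κ≤y _ _))

  private
    dualIsBoundedLattice = record
      { isLattice = Lat.∧-∨-isLattice lattice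
      ; maximum   = minimum
      ; minimum   = maximum
      }

  dualIsPAlgebra : IsPAlgebra _≈_ (flip _≤_) _∧_ _∨_ _⁺ ⊥ ⊤
  dualIsPAlgebra = record
    { isBoundedLattice = dualIsBoundedLattice
    ; ∧-distribˡ-∨     = ∨-distribˡ-∧
    ; pseudocomplement = dualPseudocomplement
    }

  dualIsDualPAlgebra : IsDualPAlgebra _≈_ (flip _≤_) _∧_ _∨_ _* ⊥ ⊤
  dualIsDualPAlgebra = record
    { isBoundedLattice     = dualIsBoundedLattice
    ; ∧-distribˡ-∨         = ∨-distribˡ-∧
    ; dualPseudocomplement = pseudocomplement
    }

  -- Regularity with its two variables exchanged: the smaller side `y ∧ (y ⁺)` is now absorbed by a
  -- meet.
  dualRegular : Terms.Regular _∧_ _∨_ _⁺ _* _≈_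
  dualRegular x y = y≤x⇒x∧y≈y (x∧x⁺≤y∨y* y x)

module _
  {A : Set a} {_≈_ : Rel A ℓ₁} {_≤_ : Rel A ℓ₂} {_∨_ _∧_ : Op₂ A} {⊤ ⊥ : A}
  where

  module FromHeyting {_⇨_ : Op₂ A} (isHeytingAlgebra : IsHeytingAlgebra _≈_ _≤_ _∨_ _∧_ _⇨_ ⊤ ⊥) where

    open IsHeytingAlgebra isHeytingAlgebra

    heytingAlgebra : HeytingAlgebra _ _ _
    heytingAlgebra = record { isHeytingAlgebra = isHeytingAlgebra }

    open Heyting heytingAlgebra using (⇨-applyʳ; swap-transpose-⇨; ∧-distribˡ-∨)

    isPAlgebra : IsPAlgebra _≈_ _≤_ _∨_ _∧_ (_⇨ ⊥) ⊤ ⊥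
    isPAlgebra = record
      { isBoundedLattice = isBoundedLattice
      ; ∧-distribˡ-∨     = ∧-distribˡ-∨
      ; pseudocomplement = λ x →
          antisym (⇨-applyʳ refl) (minimum _) , λ z x∧z≈⊥ → swap-transpose-⇨ (reflexive x∧z≈⊥)
      }

    ⇨≈κ : ∀ {_⁺ : Op₁ A} → IsDualPAlgebra _≈_ _≤_ _∨_ _∧_ _⁺ ⊤ ⊥ →
      Terms.Regular _∨_ _∧_ (_⇨ ⊥) _⁺ _≈_ →
      ∀ x y → (x ⇨ y) ≈ Terms.κ _∨_ _∧_ (_⇨ ⊥) _⁺ x y
    ⇨≈κ isDualPAlgebra regular x y =
      RegularDoublePAlgebra.κ-unique isPAlgebra isDualPAlgebra regular
        (⇨-applyʳ refl) (λ z → swap-transpose-⇨)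

  module FromDualHeyting {_⇦_ : Op₂ A}
    (isDualHeytingAlgebra : IsDualHeytingAlgebra _≈_ _≤_ _∨_ _∧_ _⇦_ ⊤ ⊥) where

    open IsDualHeytingAlgebra isDualHeytingAlgebra

    -- Distributivity is an argument because the p-algebra structure on the same lattice supplies
    -- it.
    isDualPAlgebra : _DistributesOverˡ_ _≈_ _∧_ _∨_ →
      IsDualPAlgebra _≈_ _≤_ _∨_ _∧_ (_⇦ ⊤) ⊤ ⊥
    isDualPAlgebra ∧-distribˡ-∨ = record
      { isBoundedLattice     = isBoundedLattice
      ; ∧-distribˡ-∨         = ∧-distribˡ-∨
      ; dualPseudocomplement = λ x →
          antisym (maximum _) (proj₁ (dualExponential x ⊤)) ,
          λ z x∨z≈⊤ → proj₂ (dualExponential x ⊤) z (reflexive (Eq.sym x∨z≈⊤))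
      }

    -- In the opposite algebra `⇦` is the relative pseudocomplement and `κ` unfolds to `κᵈ`, so the
    -- uniqueness of `κ` there is the claim.
    ⇦≈κᵈ : ∀ {_* : Op₁ A} → IsPAlgebra _≈_ _≤_ _∨_ _∧_ _* ⊤ ⊥ →
      Terms.Regular _∨_ _∧_ _* (_⇦ ⊤) _≈_ →
      ∀ x y → (x ⇦ y) ≈ Terms.κᵈ _∨_ _∧_ _* (_⇦ ⊤) x y
    ⇦≈κᵈ isPAlgebra regular x y =
      RegularDoublePAlgebra.κ-unique D.dualIsPAlgebra D.dualIsDualPAlgebra D.dualRegular
        (proj₁ (dualExponential x y)) (proj₂ (dualExponential x y))
      where
      module D = RegularDoublePAlgebra isPAlgebra
        (isDualPAlgebra (IsPAlgebra.∧-distribˡ-∨ isPAlgebra)) regular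

theorem2p2 : (c ℓ₁ ℓ₂ : Level) →
    ((A : RDPCH c ℓ₁ ℓ₂) → let open RDPCH A in
    ∀ x y → (x ⇨ y) ≈ κ x y)
    × ((A : RPCHᵈ c ℓ₁ ℓ₂) → let open RPCHᵈ A in
    ∀ x y → (x ⇦ y) ≈ κᵈ x y)
    × ((A : RDBLH c ℓ₁ ℓ₂) → let open RDBLH A in
    (∀ x y → (x ⇨ y) ≈ κ x y) × (∀ x y → (x ⇦ y) ≈ κᵈ x y))
theorem2p2 c ℓ₁ ℓ₂ =
    (λ A → let open RDPCH A in
      FromHeyting.⇨≈κ isHeytingAlgebra isDualPAlgebra regular)
  , (λ A → let open RPCHᵈ A in
      FromDualHeyting.⇦≈κᵈ isDualHeytingAlgebra isPAlgebra regular)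
  , (λ A → let open RDBLH A
               isPAlgebra     = FromHeyting.isPAlgebra isHeytingAlgebra
               isDualPAlgebra = FromDualHeyting.isDualPAlgebra isDualHeytingAlgebra
                                  (IsPAlgebra.∧-distribˡ-∨ isPAlgebra)
           in FromHeyting.⇨≈κ isHeytingAlgebra isDualPAlgebra regular
            , FromDualHeyting.⇦≈κᵈ isDualHeytingAlgebra isPAlgebra regular)
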